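{- For $n\ge 3$ and $m\ge 2$, $$sn(T(n,m))=\begin{cases}1 & \text{if } n \text{ is even},\\ \left\lfloor\frac{n+m}{2}\right\rfloor & \text{if } n \text{ is odd}.\end{cases}$$
   Context: Graphs are finite, undirected and simple. The tadpole graph $T(n,m)$ is obtained from a cycle $C_n$ on $n$ vertices and a path $P_m$ on $m$ vertices by identifying a vertex of $C_n$ with an end vertex of $P_m$ (so it has $n+m-1$ vertices). Let $G=(V,E)$ be a connected graph with chromatic number $\chi(G)=k\ge 2$. For $S\subset V$, a partial coloring on $G[S]$ is a proper coloring $\mathscr C_0$ of the induced subgraph $G[S]$ with colors from $\{1,\dots,k\}$ (not all colors need be used). It is a Sudoku coloring of $G$ if there is exactly one proper $k$-coloring $V\to\{1,\dots,k\}$ of $G$ whose restriction to $S$ is $\mathscr C_0$. The Sudoku number $sn(G)$ is the smallest $|S|$ such that $G[S]$ admits a Sudoku coloring of $G$. -}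

module Defs where

open import Data.Fin.Base using (Fin; toℕ)
open import Data.Fin.Subset using (Subset; _∈_; ∣_∣)
open import Data.Nat.Base using (ℕ; suc; _+_; _∸_; _≤_; s≤s)
open import Data.Nat.Properties using (1+n≢n; +-cancelˡ-≡)
open import Data.Fin.Properties using (toℕ-injective)
open import Data.Product using (∃; ∃-syntax; ∃!; _×_; proj₁)
open import Data.Sum.Base using (_⊎_; inj₁; inj₂; swap)
open import Function.Base using (_on_)
open import Relation.Binary.Definitions using (Symmetric)
open import Relation.Binary.PropositionalEquality
  using (_≡_; _≢_; refl; sym; trans; subst; _≗_)
open import Relation.Nullary.Negation.Core using (¬_)

-- Finiteness is imposed where it matters by taking V = Fin v.
record Graph (V : Set) : Set₁ where
  field
    Adj       : V → V → Set
    symmetric : Symmetric Adj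
    loopless  : ∀ {u} → ¬ Adj u u

open Graph public

induced : ∀ {v} → Graph (Fin v) → (S : Subset v) → Graph (∃ (_∈ S))
induced G S = record
  { Adj       = Adj G on proj₁
  ; symmetric = symmetric G
  ; loopless  = loopless G
  }

Proper : ∀ {V : Set} {k} → Graph V → (V → Fin k) → Set
Proper G c = ∀ {u v} → Adj G u v → c u ≢ c v

Colorable : ∀ {V : Set} → Graph V → ℕ → Set
Colorable {V} G k = ∃[ c ] Proper {V} {k} G c

IsChromaticNumber : ∀ {V : Set} → Graph V → ℕ → Set
IsChromaticNumber G k = Colorable G k × (∀ j → Colorable G j → k ≤ j)

module _ {v k : ℕ} (G : Graph (Fin v)) (S : Subset v) where

  Extends : (Fin v → Fin k) → (∃ (_∈ S) → Fin k) → Set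
  Extends c c₀ = ∀ s → c (proj₁ s) ≡ c₀ s

  -- Colorings are compared pointwise, as functions are not extensional here.
  IsSudokuColoring : (∃ (_∈ S) → Fin k) → Set
  IsSudokuColoring c₀ =
    Proper (induced G S) c₀ × ∃! _≗_ (λ c → Proper G c × Extends c c₀)

AdmitsSudokuColoring : ∀ {v} → Graph (Fin v) → ℕ → Subset v → Set
AdmitsSudokuColoring G k S = ∃[ c₀ ] IsSudokuColoring {k = k} G S c₀

-- sn(G) = s.  The notion is usually reserved for connected G with χ(G) ≥ 2;
-- the definition makes sense, and is given here, without that restriction.
IsSudokuNumber : ∀ {v} → Graph (Fin v) → ℕ → Set
IsSudokuNumber G s = ∃[ k ]
  IsChromaticNumber G k
  × (∃[ S ] ∣ S ∣ ≡ s × AdmitsSudokuColoring G k S)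
  × (∀ S → AdmitsSudokuColoring G k S → s ≤ ∣ S ∣)

data PathStep {m} (i j : Fin m) : Set where
  step : suc (toℕ i) ≡ toℕ j → PathStep i j

data CycleStep {n} (i j : Fin n) : Set where
  step : suc (toℕ i) ≡ toℕ j → CycleStep i j
  wrap : suc (toℕ i) ≡ n → toℕ j ≡ 0 → CycleStep i j

private
  pathStep-irrefl : ∀ {m} {i : Fin m} → ¬ PathStep i i
  pathStep-irrefl (step e) = 1+n≢n e

  cycleStep-irrefl : ∀ {n} → 3 ≤ n → {i : Fin n} → ¬ CycleStep i i
  cycleStep-irrefl _   (step e) = 1+n≢n e
  cycleStep-irrefl n≥3 (wrap e z) with subst (λ x → suc x ≡ _) z e
  cycleStep-irrefl (s≤s ()) (wrap e z) | refl

undirected : ∀ {V : Set} (R : V → V → Set) → (∀ {u} → ¬ R u u) → Graph V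
undirected R irr = record
  { Adj       = λ u v → R u v ⊎ R v u
  ; symmetric = swap
  ; loopless  = λ { (inj₁ r) → irr r ; (inj₂ r) → irr r }
  }

path : ∀ m → Graph (Fin m)
path m = undirected PathStep pathStep-irrefl

cycle : ∀ n → 3 ≤ n → Graph (Fin n)
cycle n n≥3 = undirected CycleStep (cycleStep-irrefl n≥3)

-- For m ≥ 1.  Vertex i of the cycle becomes vertex i, and vertex j of the path
-- becomes vertex (n − 1) + j, so the last vertex of the cycle is identified
-- with the first (end) vertex of the path and no other vertices are merged.
data TadpoleAdj (n m : ℕ) (n≥3 : 3 ≤ n) (u v : Fin (n + m ∸ 1)) : Set where
  onCycle : ∀ {i j} → Adj (cycle n n≥3) i j →
            toℕ u ≡ toℕ i → toℕ v ≡ toℕ j → TadpoleAdj n m n≥3 u v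
  onPath  : ∀ {i j} → Adj (path m) i j →
            toℕ u ≡ (n ∸ 1) + toℕ i → toℕ v ≡ (n ∸ 1) + toℕ j →
            TadpoleAdj n m n≥3 u v

tadpole : ∀ n m → 3 ≤ n → Graph (Fin (n + m ∸ 1))
tadpole n m n≥3 = record
  { Adj       = TadpoleAdj n m n≥3
  ; symmetric = λ
    { (onCycle a p q) → onCycle (swap a) q p
    ; (onPath  a p q) → onPath  (swap a) q p
    }
  ; loopless  = λ
    { (onCycle {i} a p q) → loopless (cycle n n≥3)
        (subst (Adj (cycle n n≥3) i)
               (sym (toℕ-injective (trans (sym p) q))) a)
    ; (onPath {i} a p q) → loopless (path m)
        (subst (Adj (path m) i)
               (sym (toℕ-injective (+-cancelˡ-≡ (n ∸ 1) _ _ (trans (sym p) q)))) a)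
    }
  }

{-# OPTIONS --safe #-}
-- With p = n − 1, the tadpole is the path 0, 1, …, p + m − 1 together with the
-- chord {0, p}.
--
-- Lower bound for odd n: if the coloring c is the only extension of its
-- restriction to S, then every Kempe chain of c meets S, since exchanging its
-- two colors would give another extension.  For three colors this forces the
-- leaf into S, forbids two adjacent vertices of degree at most two outside S,
-- and forbids p together with two of its neighbors outside S.  So at most one
-- pair of consecutive vertices of the path lies outside S, and counting along
-- the path, cut between these two vertices, shows that S contains at least
-- half of the vertices.
--
-- Upper bound for odd n: prescribe the coloring 1 0 2 1 2 0 2 1 2 … on the odd
-- vertices and on the leaf.  Each even vertex other than 0 and the leaf lies
-- between the colors 0 and 1; then 0 lies between 1 and p.
--
-- For even n, a 2-coloring of a connected graph is determined by one vertex,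
-- and by no fewer because the two colors can be exchanged.
module Submission where

open import Defs
open import Data.Nat.Base using (ℕ; _+_; _≤_; ⌊_/2⌋)
open import Data.Nat.Divisibility using (_∣_)
open import Data.Product.Base using (_×_)
open import Relation.Nullary.Negation.Core using (¬_)

open import Data.Bool.Base using (if_then_else_)
open import Data.Fin.Base using (Fin; zero; suc; toℕ; fromℕ<; opposite; inject≤)
open import Data.Fin.Patterns using (0F; 1F; 2F)
open import Data.Fin.Permutation.Components using (transpose; transpose-inverse)
open import Data.Fin.Properties
  using (_≟_; all?; any?; opposite-involutive; toℕ<n; toℕ-fromℕ<; toℕ-injective; inject≤-injective)
open import Data.Fin.Subset
  using (Subset; Side; inside; outside; _∈_; _∉_; ∣_∣; ⁅_⁆)
open import Data.Fin.Subset.Properties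
  using (_∈?_; p⊆q⇒∣p∣≤∣q∣; x∈⁅x⁆; x∈⁅y⁆⇒x≡y; ∣⁅x⁆∣≡1)
open import Data.Nat.Base using (zero; suc; _*_; _<_; z≤n; s≤s; s≤s⁻¹)
open import Data.Nat.Divisibility using (divides)
open import Data.Nat.Properties as ℕ
  using ( ≤-refl; ≤-trans; ≤-reflexive; ≮⇒≥; ≰⇒>; _≤?_; _<?_; suc-injective; n≤1+n; 1+n≰n
        ; m≤n⇒m≤1+n; m≤m+n; m≤n⇒∃[o]m+o≡n; +-suc; +-cancelˡ-<; +-mono-≤; +-monoʳ-<
        ; *-distribʳ-+; ⌊n/2⌋-mono )
open import Data.Product.Base using (∃-syntax; _,_; proj₁; proj₂)
open import Data.Sum.Base using (_⊎_; inj₁; inj₂; [_,_]′)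
open import Data.Unit.Base using (⊤; tt)
open import Data.Vec.Base using ([]; _∷_; here; there)
open import Function.Base using (_∘_)
open import Relation.Binary.PropositionalEquality
  using (_≡_; _≢_; refl; sym; trans; cong; subst; _≗_; ≢-sym)
open import Relation.Nullary.Decidable
  using (yes; no; does; dec-true; from-yes; ¬?; _×-dec_; _⊎-dec_; _→-dec_)
open import Relation.Nullary.Negation.Core using (contradiction)
open import Relation.Unary using (Pred; Decidable)
open import Level using (0ℓ)

-- Colors

transpose-cases : ∀ {k} (x y z : Fin k) →
  (z ≡ x × transpose x y z ≡ y) ⊎ (z ≡ y × transpose x y z ≡ x) ⊎ transpose x y z ≡ z
transpose-cases x y z with z ≟ x
... | yes z≡x = inj₁ (z≡x , refl)
... | no  _ with z ≟ y
...   | yes z≡y = inj₂ (inj₁ (z≡y , refl))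
...   | no  _   = inj₂ (inj₂ refl)

transpose-left : ∀ {k} (x y : Fin k) → transpose x y x ≡ y
transpose-left x y rewrite dec-true (x ≟ x) refl = refl

transpose-injective : ∀ {k} (x y : Fin k) {z w} → transpose x y z ≡ transpose x y w → z ≡ w
transpose-injective x y e =
  trans (sym (transpose-inverse y x)) (trans (cong (transpose y x) e) (transpose-inverse y x))

third-color : (a b : Fin 3) → ∃[ x ] x ≢ a × x ≢ b
third-color = from-yes (all? {n = 3} λ a → all? λ b → any? λ x → ¬? (x ≟ a) ×-dec ¬? (x ≟ b))

third-color-unique : (a b x y : Fin 3) → a ≢ b → x ≢ a → x ≢ b → y ≢ a → y ≢ b → x ≡ y
third-color-unique = from-yes (all? {n = 3} λ a → all? λ b → all? λ x → all? λ y →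
  ¬? (a ≟ b) →-dec ¬? (x ≟ a) →-dec ¬? (x ≟ b) →-dec ¬? (y ≟ a) →-dec ¬? (y ≟ b) →-dec x ≟ y)

second-color : (x y : Fin 2) → x ≢ y → y ≡ opposite x
second-color = from-yes (all? {n = 2} λ x → all? λ y → ¬? (x ≟ y) →-dec y ≟ opposite x)

-- Lets a chromatic number be bounded below by excluding a single number of colors.
Colorable-mono : ∀ {V : Set} {G : Graph V} {j k} → j ≤ k → Colorable G j → Colorable G k
Colorable-mono j≤k (c , proper) =
  (λ u → inject≤ (c u) j≤k) , λ a e → proper a (inject≤-injective j≤k j≤k _ _ e)

-- Unique extension and Kempe chains

-- A partial coloring is the restriction of its extension, so the argument can speak of total
-- colorings only.
Determines : ∀ {v k} → Graph (Fin v) → Subset v → (Fin v → Fin k) → Set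
Determines G S c = ∀ {d} → Proper G d → (∀ {u} → u ∈ S → c u ≡ d u) → c ≗ d

determines⇒admits : ∀ {v k} {G : Graph (Fin v)} {S} {c : Fin v → Fin k} →
  Proper G c → Determines G S c → AdmitsSudokuColoring G k S
determines⇒admits {c = c} proper determines =
    (λ s → c (proj₁ s)) , (λ a → proper a) , c , (proper , λ _ → refl)
  , λ (proper′ , extends) → determines proper′ λ u∈S → sym (extends (_ , u∈S))

admits⇒determines : ∀ {v k} {G : Graph (Fin v)} {S} → AdmitsSudokuColoring G k S →
  ∃[ c ] Proper {k = k} G c × Determines G S c
admits⇒determines (_ , _ , c , (proper , extends) , unique) =
  c , proper , λ proper′ agree → unique
    (proper′ , λ s → trans (sym (agree (proj₂ s))) (extends s))

module _ {v k : ℕ} {G : Graph (Fin v)} {S : Subset v} {c : Fin v → Fin k}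
         (proper : Proper G c) (determines : Determines G S c) where

  -- K is a union of Kempe chains for the colors x and y, possibly with vertices
  -- of other colors added.
  kempe : {K : Pred (Fin v) 0ℓ} → Decidable K → ∀ {x y} → x ≢ y →
    (∀ {u} → K u → u ∉ S) →
    (∀ {u w} → Adj G u w → K u → ¬ K w → c u ≡ x ⊎ c u ≡ y → c w ≢ x × c w ≢ y) →
    ∀ {u} → K u → c u ≢ x
  kempe {K} K? {x} {y} x≢y K⊆∁S closed {u} Ku cu≡x = x≢y (trans (sym cu≡x)
      (trans (determines exchanged-proper agree u)
        (trans (exchanged-in Ku) (trans (cong (transpose x y) cu≡x) (transpose-left x y)))))
    where
    exchanged : Fin v → Fin k
    exchanged u = if does (K? u) then transpose x y (c u) else c u

    exchanged-in : ∀ {u} → K u → exchanged u ≡ transpose x y (c u)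
    exchanged-in {u} Ku rewrite dec-true (K? u) Ku = refl

    -- An edge leaving `K` stays proper: if its inner end changes color, `closed` keeps both `x` and
    -- `y` away from the outer end; otherwise properness of `c` suffices.
    boundary : ∀ {u w} → Adj G u w → K u → ¬ K w → transpose x y (c u) ≢ c w
    boundary {u} {w} a Ku ¬Kw e with transpose-cases x y (c u)
    ... | inj₁ (cu≡x , t≡y)        = proj₂ (closed a Ku ¬Kw (inj₁ cu≡x)) (trans (sym e) t≡y)
    ... | inj₂ (inj₁ (cu≡y , t≡x)) = proj₁ (closed a Ku ¬Kw (inj₂ cu≡y)) (trans (sym e) t≡x)
    ... | inj₂ (inj₂ t≡cu)         = proper a (trans (sym t≡cu) e)

    exchanged-proper : Proper G exchanged
    exchanged-proper {u} {w} a with K? u | K? w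
    ... | yes _  | yes _  = proper a ∘ transpose-injective x y
    ... | yes Ku | no ¬Kw = boundary a Ku ¬Kw
    ... | no ¬Ku | yes Kw = boundary (symmetric G a) Kw ¬Ku ∘ sym
    ... | no _   | no _   = proper a

    agree : ∀ {u} → u ∈ S → c u ≡ exchanged u
    agree {u} u∈S with K? u
    ... | yes Ku = contradiction u∈S (K⊆∁S Ku)
    ... | no _   = refl

-- Only an upper bound on the neighborhood, with `a` and `b` allowed to coincide, so that it also
-- fits the leaf.
NeighborsIn : ∀ {v} → Graph (Fin v) → Fin v → Fin v → Fin v → Set
NeighborsIn G u a b = ∀ {w} → Adj G u w → w ≡ a ⊎ w ≡ b

module _ {v : ℕ} {G : Graph (Fin v)} {S : Subset v} {c : Fin v → Fin 3}
         (proper : Proper G c) (determines : Determines G S c) where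

  -- If the colors agreed, a third color would be free at `u`, making `u` alone a Kempe chain that
  -- avoids `S`. With `a` equal to `b` this forces the leaf into `S`.
  neighbors-differ : ∀ {u a b} → NeighborsIn G u a b → u ∉ S → c a ≢ c b
  neighbors-differ {u} {a} {b} nbrs u∉S ca≡cb with third-color (c u) (c a)
  ... | x , x≢cu , x≢ca =
    kempe {G = G} {S} {c} proper determines {_≡ u} (_≟ u) (≢-sym x≢cu)
      (λ { refl → u∉S }) closed refl refl
    where
    closed : ∀ {z w} → Adj G z w → z ≡ u → w ≢ u → c z ≡ c u ⊎ c z ≡ x → c w ≢ c u × c w ≢ x
    closed adj refl _ _ = (λ e → proper adj (sym e)) , avoids (nbrs adj)
      where
      avoids : ∀ {w} → w ≡ a ⊎ w ≡ b → c w ≢ x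
      avoids (inj₁ refl) e = x≢ca (sym e)
      avoids (inj₂ refl) e = x≢ca (trans (sym e) (sym ca≡cb))

  -- The two vertices form a Kempe chain for their own colors: the outer neighbor of each differs
  -- from it by properness, and from the other end by `neighbors-differ`.
  no-edge-outside : ∀ {u w a b} → Adj G u w → NeighborsIn G u w a → NeighborsIn G w u b →
    ¬ (u ∉ S × w ∉ S)
  no-edge-outside {u} {w} {a} {b} adj nbrs-u nbrs-w (u∉S , w∉S) =
    kempe {G = G} {S} {c} proper determines {λ z → z ≡ u ⊎ z ≡ w}
      (λ z → z ≟ u ⊎-dec z ≟ w) (proper adj)
      (λ { (inj₁ refl) → u∉S ; (inj₂ refl) → w∉S }) closed (inj₁ refl) refl
    where
    closed : ∀ {z t} → Adj G z t → z ≡ u ⊎ z ≡ w → ¬ (t ≡ u ⊎ t ≡ w) →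
      c z ≡ c u ⊎ c z ≡ c w → c t ≢ c u × c t ≢ c w
    closed zt (inj₁ refl) t∉ _ with nbrs-u zt
    ... | inj₁ refl = contradiction (inj₂ refl) t∉
    ... | inj₂ refl = ≢-sym (proper zt) , ≢-sym (neighbors-differ nbrs-u u∉S)
    closed zt (inj₂ refl) t∉ _ with nbrs-w zt
    ... | inj₁ refl = contradiction (inj₁ refl) t∉
    ... | inj₂ refl = ≢-sym (neighbors-differ nbrs-w w∉S) , ≢-sym (proper zt)

  -- Since `x` avoids `c u` and `c d`, the chain for `c u` and `x` from `u` does not enter `d`. It
  -- ends at `a` or `b` at the latest, whose far neighbors differ in color from `u` by
  -- `neighbors-differ`.
  no-cherry-outside : ∀ {u a b d a′ b′} → Adj G u a → Adj G u b →
    (∀ {t} → Adj G u t → t ≡ a ⊎ t ≡ b ⊎ t ≡ d) →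
    NeighborsIn G a u a′ → NeighborsIn G b u b′ →
    u ∉ S → ¬ (a ∉ S × b ∉ S)
  no-cherry-outside {u} {a} {b} {d} ua ub nbrs-u nbrs-a nbrs-b u∉S (a∉S , b∉S)
    with third-color (c u) (c d)
  ... | x , x≢cu , x≢cd =
    kempe {G = G} {S} {c} proper determines {K}
      (λ z → z ≟ u ⊎-dec z ≟ a ⊎-dec z ≟ b) (≢-sym x≢cu)
      (λ { (inj₁ refl) → u∉S ; (inj₂ (inj₁ refl)) → a∉S ; (inj₂ (inj₂ refl)) → b∉S })
      closed (inj₁ refl) refl
    where
    K : Fin v → Set
    K z = z ≡ u ⊎ z ≡ a ⊎ z ≡ b

    closed-arm : ∀ {z z′ t} → Adj G u z → NeighborsIn G z u z′ → z ∉ S →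
      Adj G z t → t ≢ u → c z ≡ c u ⊎ c z ≡ x → c t ≢ c u × c t ≢ x
    closed-arm uz _    _   _  _   (inj₁ cz≡cu) = contradiction (sym cz≡cu) (proper uz)
    closed-arm _  nbrs z∉S zt t≢u (inj₂ cz≡x) with nbrs zt
    ... | inj₁ t≡u  = contradiction t≡u t≢u
    ... | inj₂ refl = ≢-sym (neighbors-differ nbrs z∉S) , λ ct≡x → proper zt (trans cz≡x (sym ct≡x))

    closed : ∀ {z t} → Adj G z t → K z → ¬ K t →
      c z ≡ c u ⊎ c z ≡ x → c t ≢ c u × c t ≢ x
    closed zt (inj₁ refl) t∉K _ with nbrs-u zt
    ... | inj₁ t≡a        = contradiction (inj₂ (inj₁ t≡a)) t∉K
    ... | inj₂ (inj₁ t≡b) = contradiction (inj₂ (inj₂ t≡b)) t∉K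
    ... | inj₂ (inj₂ refl) = ≢-sym (proper zt) , ≢-sym x≢cd
    closed zt (inj₂ (inj₁ refl)) t∉K = closed-arm ua nbrs-a a∉S zt (t∉K ∘ inj₁)
    closed zt (inj₂ (inj₂ refl)) t∉K = closed-arm ub nbrs-b b∉S zt (t∉K ∘ inj₁)

-- Counting

-- Indexing by natural numbers lets the sequence be shifted and cut without casts.
count : (ℕ → Side) → ℕ → ℕ
count f zero    = 0
count f (suc q) = if f 0 then suc (count (f ∘ suc) q) else count (f ∘ suc) q

count-+ : ∀ f q r → count f (q + r) ≡ count f q + count (f ∘ (q +_)) r
count-+ f zero    r = refl
count-+ f (suc q) r with f 0
... | inside  = cong suc (count-+ (f ∘ suc) q r)
... | outside = count-+ (f ∘ suc) q r

Covered : (ℕ → Side) → ℕ → Set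
Covered f i = f i ≡ inside ⊎ f (suc i) ≡ inside

-- Each outside index is paired with its successor, which exists because the last index is inside,
-- and is inside by covering.
half-if-last : ∀ f q → (∀ i → suc i < q → Covered f i) →
  (∀ {i} → suc i ≡ q → f i ≡ inside) → q ≤ count f q * 2
half-if-last f zero    cov last = z≤n
half-if-last f (suc q) cov last with f 0 in f0
... | inside = s≤s (m≤n⇒m≤1+n
        (half-if-last (f ∘ suc) q (λ i i<q → cov (suc i) (s≤s i<q)) (last ∘ cong suc)))
half-if-last f (suc zero) cov last | outside with trans (sym f0) (last refl)
... | ()
half-if-last f (suc (suc q)) cov last | outside with cov 0 (s≤s (s≤s z≤n))
... | inj₁ f0′ with trans (sym f0) f0′
...   | ()
half-if-last f (suc (suc q)) cov last | outside | inj₂ f1 rewrite f1 = s≤s (s≤s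
  (half-if-last (f ∘ (2 +_)) q (λ i i<q → cov (2 + i) (s≤s (s≤s i<q)))
    (last ∘ cong (2 +_))))

-- The mirror image: each outside index is paired with its predecessor, and what remains after each
-- step is empty or starts inside again.
half-if-first : ∀ f q → (∀ i → suc i < q → Covered f i) →
  (0 < q → f 0 ≡ inside) → q ≤ count f q * 2
half-if-first f zero       cov first = z≤n
half-if-first f (suc zero) cov first rewrite first (s≤s z≤n) = s≤s z≤n
half-if-first f (suc (suc q)) cov first = by-second (first (s≤s z≤n))
  (λ f1 → half-if-first (f ∘ suc) (suc q) (λ i i<q → cov (suc i) (s≤s i<q)) (λ _ → f1))
  (λ f1 → half-if-first (f ∘ (2 +_)) q (λ i i<q → cov (2 + i) (s≤s (s≤s i<q))) (at-2 f1))
  where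
  at-2 : f 1 ≡ outside → 0 < q → f 2 ≡ inside
  at-2 f1 0<q with cov 1 (s≤s (s≤s 0<q))
  ... | inj₂ f2  = f2
  ... | inj₁ f1′ with trans (sym f1) f1′
  ...   | ()

  by-second : f 0 ≡ inside →
    (f 1 ≡ inside → suc q ≤ count (f ∘ suc) (suc q) * 2) →
    (f 1 ≡ outside → q ≤ count (f ∘ (2 +_)) q * 2) →
    suc (suc q) ≤ count f (suc (suc q)) * 2
  by-second f0 rec₁ rec₂ rewrite f0 with f 1
  ... | inside  = s≤s (m≤n⇒m≤1+n (rec₁ refl))
  ... | outside = s≤s (s≤s (rec₂ refl))

-- The indices just below and at `q` may both be outside. Cutting between them leaves a block that
-- starts inside and one that ends inside, and the two bounds add.
half-if-cut : ∀ f q r {v} → q + r ≡ v → f 0 ≡ inside →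
  (∀ i → suc i < v → suc i ≢ q → Covered f i) →
  (∀ {i} → suc i ≡ v → f i ≡ inside) → v ≤ count f v * 2
half-if-cut f q r refl first cov last =
  ≤-trans (+-mono-≤ below above)
    (≤-reflexive (trans (sym (*-distribʳ-+ 2 (count f q) _)) (cong (_* 2) (sym (count-+ f q r)))))
  where
  below : q ≤ count f q * 2
  below = half-if-first f q
    (λ i i<q → cov i (≤-trans i<q (m≤m+n q r)) (λ { refl → 1+n≰n i<q })) (λ _ → first)

  above : r ≤ count (f ∘ (q +_)) r * 2
  above = half-if-last (f ∘ (q +_)) r
    (λ i i<r → subst (λ j → f (q + i) ≡ inside ⊎ f j ≡ inside) (sym (+-suc q i))
      (cov (q + i) (subst (_< q + r) (+-suc q i) (+-monoʳ-< q i<r))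
        (λ e → 1+n≰n (≤-trans (s≤s (m≤m+n q i)) (≤-reflexive e)))))
    (λ {i} e → last (trans (sym (+-suc q i)) (cong (q +_) e)))

-- Indices beyond the last are outside.
side : ∀ {v} → Subset v → ℕ → Side
side []      _       = outside
side (x ∷ S) zero    = x
side (x ∷ S) (suc i) = side S i

count-side : ∀ {v} (S : Subset v) → count (side S) v ≡ ∣ S ∣
count-side []            = refl
count-side (inside  ∷ S) = cong suc (count-side S)
count-side (outside ∷ S) = count-side S

side-inside : ∀ {v} {S : Subset v} {u} → u ∈ S → side S (toℕ u) ≡ inside
side-inside here        = refl
side-inside (there u∈S) = side-inside u∈S

side-outside : ∀ {v} {S : Subset v} {u i} → toℕ u ≡ i → side S i ≡ outside → u ∉ S
side-outside refl e u∈S with trans (sym e) (side-inside u∈S)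
... | ()

one-inside : ∀ {v} (S : Subset v) {u w i j} → toℕ u ≡ i → toℕ w ≡ j →
  ¬ (u ∉ S × w ∉ S) → side S i ≡ inside ⊎ side S j ≡ inside
one-inside S {u} {w} refl refl not-both with u ∈? S | w ∈? S
... | yes u∈S | _       = inj₁ (side-inside u∈S)
... | no _    | yes w∈S = inj₂ (side-inside w∈S)
... | no u∉S  | no w∉S  = contradiction (u∉S , w∉S) not-both

inside-or-outside : ∀ (x : Side) → x ≡ inside ⊎ x ≡ outside
inside-or-outside inside  = inj₁ refl
inside-or-outside outside = inj₂ refl

-- The odd indices and the last one; for odd `v` the last index is even, which is the case
-- `inside ∷ []`.
alternate : ∀ v → Subset v
alternate zero          = []
alternate (suc zero)    = inside ∷ []
alternate (suc (suc v)) = outside ∷ inside ∷ alternate v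

∣alternate∣ : ∀ v → ∣ alternate v ∣ ≡ ⌊ suc v /2⌋
∣alternate∣ zero          = refl
∣alternate∣ (suc zero)    = refl
∣alternate∣ (suc (suc v)) = cong suc (∣alternate∣ v)

odd∈alternate : ∀ {v} (u : Fin v) j → toℕ u ≡ suc (j * 2) → u ∈ alternate v
odd∈alternate {suc (suc v)} (suc zero)    j       e = there here
odd∈alternate {suc (suc v)} (suc (suc u)) (suc j) e =
  there (there (odd∈alternate u j (suc-injective (suc-injective e))))

-- The bound supplies the successor that serves as second colored neighbor of an unprescribed
-- vertex.
∉alternate⇒even : ∀ {v} (u : Fin v) → u ∉ alternate v →
  (∃[ j ] toℕ u ≡ j * 2) × suc (toℕ u) < v
∉alternate⇒even {suc zero}    zero       u∉ = contradiction here u∉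
∉alternate⇒even {suc (suc v)} zero       u∉ = (0 , refl) , s≤s (s≤s z≤n)
∉alternate⇒even {suc (suc v)} (suc zero) u∉ = contradiction (there here) u∉
∉alternate⇒even {suc (suc v)} (suc (suc u)) u∉ with ∉alternate⇒even u (u∉ ∘ there ∘ there)
... | (j , e) , u<v = (suc j , cong (2 +_) e) , s≤s (s≤s u<v)

-- Color sequences

alternating : Fin 2 → ℕ → Fin 2
alternating x zero    = x
alternating x (suc i) = opposite (alternating x i)

alternating-even : ∀ x s → alternating x (s * 2) ≡ x
alternating-even x zero    = refl
alternating-even x (suc s) =
  trans (opposite-involutive (alternating x (s * 2))) (alternating-even x s)

opposite-differs : (x : Fin 2) → opposite x ≢ x
opposite-differs 0F ()
opposite-differs 1F ()

-- The index is shifted: `colors₁ i` is the color of vertex `suc i`. Odd vertices alternate between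
-- 0 and 1, positive even ones get 2.
colors₁ : ℕ → Fin 3
colors₁ 0 = 0F
colors₁ 1 = 2F
colors₁ 2 = 1F
colors₁ 3 = 2F
colors₁ (suc (suc (suc (suc i)))) = colors₁ i

colors : ℕ → Fin 3
colors zero    = 1F
colors (suc i) = colors₁ i

colors₁-step : ∀ i → colors₁ i ≢ colors₁ (suc i)
colors₁-step 0 ()
colors₁-step 1 ()
colors₁-step 2 ()
colors₁-step 3 ()
colors₁-step (suc (suc (suc (suc i)))) = colors₁-step i

colors-step : ∀ i → colors i ≢ colors (suc i)
colors-step zero    ()
colors-step (suc i) = colors₁-step i

colors₁-odd : ∀ s → colors₁ (suc (s * 2)) ≡ 2F
colors₁-odd zero          = refl
colors₁-odd (suc zero)    = refl
colors₁-odd (suc (suc s)) = colors₁-odd s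

-- Consecutive odd vertices differ in color, which forces the even vertex between them.
colors₁-even-step : ∀ j → colors₁ (j * 2) ≢ colors₁ (suc j * 2)
colors₁-even-step zero          ()
colors₁-even-step (suc zero)    ()
colors₁-even-step (suc (suc j)) = colors₁-even-step j

even-or-odd : ∀ k → (∃[ s ] k ≡ s * 2) ⊎ (∃[ s ] k ≡ suc (s * 2))
even-or-odd zero = inj₁ (0 , refl)
even-or-odd (suc k) with even-or-odd k
... | inj₁ (s , e) = inj₂ (s , cong suc e)
... | inj₂ (s , e) = inj₁ (suc s , cong suc e)

⌊1+k*2/2⌋ : ∀ k → ⌊ suc (k * 2) /2⌋ ≡ k
⌊1+k*2/2⌋ zero    = refl
⌊1+k*2/2⌋ (suc k) = cong suc (⌊1+k*2/2⌋ k)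

-- The tadpole

Link : ℕ → ℕ → ℕ → Set
Link p i j = suc i ≡ j ⊎ suc j ≡ i ⊎ (i ≡ 0 × j ≡ p) ⊎ (i ≡ p × j ≡ 0)

module Tadpole (p₀ m₀ : ℕ) (n≥3 : 3 ≤ 3 + p₀) where

  -- In this form `suc p + m ∸ 1` computes to `N`, and `suc N` is the sum of the two parameters of
  -- the tadpole.
  p m N : ℕ
  p = 2 + p₀
  m = 2 + m₀
  N = p + m

  T : Graph (Fin N)
  T = tadpole (suc p) m n≥3

  2+p≤N : 2 + p ≤ N
  2+p≤N = ≤-trans (s≤s (s≤s (m≤m+n p m₀)))
    (≤-reflexive (sym (trans (+-suc p (suc m₀)) (cong suc (+-suc p m₀)))))

  p<N : p < N
  p<N = ≤-trans (n≤1+n _) 2+p≤N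

  vertex : ∀ i → i < N → ∃[ u ] toℕ {N} u ≡ i
  vertex i i<N = fromℕ< i<N , toℕ-fromℕ< i<N

  same : ∀ {u v : Fin N} {i} → toℕ u ≡ i → toℕ v ≡ i → u ≡ v
  same e e′ = toℕ-injective (trans e (sym e′))

  adj⇒link : ∀ {u v} → Adj T u v → Link p (toℕ u) (toℕ v)
  adj⇒link (onCycle (inj₁ (step e)) eu ev) = inj₁ (trans (cong suc eu) (trans e (sym ev)))
  adj⇒link (onCycle (inj₁ (wrap e z)) eu ev) =
    inj₂ (inj₂ (inj₂ (trans eu (suc-injective e) , trans ev z)))
  adj⇒link (onCycle (inj₂ (step e)) eu ev) =
    inj₂ (inj₁ (trans (cong suc ev) (trans e (sym eu))))
  adj⇒link (onCycle (inj₂ (wrap e z)) eu ev) =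
    inj₂ (inj₂ (inj₁ (trans eu z , trans ev (suc-injective e))))
  adj⇒link (onPath (inj₁ (step e)) eu ev) =
    inj₁ (trans (cong suc eu) (trans (sym (+-suc p _)) (trans (cong (p +_) e) (sym ev))))
  adj⇒link (onPath (inj₂ (step e)) eu ev) =
    inj₂ (inj₁ (trans (cong suc ev) (trans (sym (+-suc p _)) (trans (cong (p +_) e) (sym eu)))))

  -- Up to `p` the step lies on the cycle; beyond, it lies on the attached path, where `u` has
  -- offset `o` from `p`.
  next-adj : ∀ {u v} → suc (toℕ u) ≡ toℕ v → Adj T u v
  next-adj {u} {v} e with toℕ v ≤? p
  ... | yes v≤p = onCycle {i = fromℕ< u<n} {fromℕ< (s≤s v≤p)}
      (inj₁ (step (trans (cong suc (toℕ-fromℕ< u<n)) (trans e (sym (toℕ-fromℕ< (s≤s v≤p)))))))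
      (sym (toℕ-fromℕ< u<n)) (sym (toℕ-fromℕ< (s≤s v≤p)))
    where
    u<n : toℕ u < suc p
    u<n = ≤-trans (≤-reflexive e) (m≤n⇒m≤1+n v≤p)
  ... | no v≰p with m≤n⇒∃[o]m+o≡n (s≤s⁻¹ (≤-trans (≰⇒> v≰p) (≤-reflexive (sym e))))
  ...   | o , p+o≡u = onPath {i = fromℕ< o<m} {fromℕ< 1+o<m}
      (inj₁ (step (trans (cong suc (toℕ-fromℕ< o<m)) (sym (toℕ-fromℕ< 1+o<m)))))
      (trans (sym p+o≡u) (cong (p +_) (sym (toℕ-fromℕ< o<m))))
      (trans (sym p+1+o≡v) (cong (p +_) (sym (toℕ-fromℕ< 1+o<m))))
    where
    p+1+o≡v : p + suc o ≡ toℕ v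
    p+1+o≡v = trans (+-suc p o) (trans (cong suc p+o≡u) e)
    1+o<m : suc o < m
    1+o<m = +-cancelˡ-< p _ _ (≤-trans (≤-reflexive (cong suc p+1+o≡v)) (toℕ<n v))
    o<m : o < m
    o<m = ≤-trans (n≤1+n _) 1+o<m

  chord-adj : ∀ {u v} → toℕ u ≡ 0 → toℕ v ≡ p → Adj T u v
  chord-adj eu ev = onCycle {i = 0F} {fromℕ< ≤-refl}
    (inj₂ (wrap (cong suc (toℕ-fromℕ< ≤-refl)) refl)) eu (trans ev (sym (toℕ-fromℕ< ≤-refl)))

  -- The second neighbor of vertex 0 is `p`, by the chord; that of any other vertex except `p` is
  -- its predecessor.
  next-neighbors : ∀ {u v i} → toℕ u ≡ i → toℕ v ≡ suc i → i ≢ p → ∃[ a ] NeighborsIn T u v a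
  next-neighbors {u} {v} {zero} eu ev 0≢p with vertex p p<N
  ... | a , ea = a , λ {w} → nbrs w ∘ adj⇒link
    where
    nbrs : ∀ w → Link p (toℕ u) (toℕ w) → w ≡ v ⊎ w ≡ a
    nbrs w (inj₁ e) = inj₁ (same (trans (sym e) (cong suc eu)) ev)
    nbrs w (inj₂ (inj₁ e)) with trans e eu
    ... | ()
    nbrs w (inj₂ (inj₂ (inj₁ (_ , ew)))) = inj₂ (same ew ea)
    nbrs w (inj₂ (inj₂ (inj₂ (u≡p , _)))) = contradiction (trans (sym eu) u≡p) 0≢p
  next-neighbors {u} {v} {suc i} eu ev i≢p
    with vertex i (≤-trans (n≤1+n _) (subst (_< N) eu (toℕ<n u)))
  ... | a , ea = a , λ {w} → nbrs w ∘ adj⇒link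
    where
    nbrs : ∀ w → Link p (toℕ u) (toℕ w) → w ≡ v ⊎ w ≡ a
    nbrs w (inj₁ e) = inj₁ (same (trans (sym e) (cong suc eu)) ev)
    nbrs w (inj₂ (inj₁ e)) = inj₂ (same (suc-injective (trans e eu)) ea)
    nbrs w (inj₂ (inj₂ (inj₁ (u≡0 , _)))) with trans (sym eu) u≡0
    ... | ()
    nbrs w (inj₂ (inj₂ (inj₂ (u≡p , _)))) = contradiction (trans (sym eu) u≡p) i≢p

  -- The second alternative is left as an equation of indices, since the leaf has no successor.
  prev-link : ∀ {u v : Fin N} {i} → toℕ u ≡ i → toℕ v ≡ suc i → suc i ≢ p →
    ∀ w → Link p (toℕ v) (toℕ w) → w ≡ u ⊎ toℕ w ≡ suc (suc i)
  prev-link eu ev v≢p w (inj₁ e) = inj₂ (trans (sym e) (cong suc ev))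
  prev-link eu ev v≢p w (inj₂ (inj₁ e)) = inj₁ (same (suc-injective (trans e ev)) eu)
  prev-link eu ev v≢p w (inj₂ (inj₂ (inj₁ (v≡0 , _)))) with trans (sym ev) v≡0
  ... | ()
  prev-link eu ev v≢p w (inj₂ (inj₂ (inj₂ (v≡p , _)))) = contradiction (trans (sym ev) v≡p) v≢p

  leaf-neighbors : ∀ {u v i} → toℕ u ≡ i → toℕ v ≡ suc i → suc i ≢ p → N ≤ suc (suc i) →
    NeighborsIn T v u u
  leaf-neighbors eu ev v≢p last {w} a with prev-link eu ev v≢p w (adj⇒link a)
  ... | inj₁ w≡u = inj₁ w≡u
  ... | inj₂ ew  = contradiction (≤-trans (subst (_< N) ew (toℕ<n w)) last) 1+n≰n

  prev-neighbors : ∀ {u v i} → toℕ u ≡ i → toℕ v ≡ suc i → suc i ≢ p → ∃[ b ] NeighborsIn T v u b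
  prev-neighbors {u} {i = i} eu ev v≢p with suc (suc i) <? N
  -- At the leaf, `u` fills both places.
  ... | no last = u , leaf-neighbors eu ev v≢p (≮⇒≥ last)
  ... | yes 2+i<N with vertex (suc (suc i)) 2+i<N
  ...   | b , eb = b , λ {w} a →
    [ inj₁ , (λ ew → inj₂ (same ew eb)) ]′ (prev-link eu ev v≢p w (adj⇒link a))

  -- Lower bound for three colors

  module _ {S : Subset N} {c : Fin N → Fin 3}
           (proper : Proper T c) (determines : Determines T S c) where

    private
      f : ℕ → Side
      f = side S

      edge-covered : ∀ i → suc i < N → i ≢ p → suc i ≢ p → Covered f i
      edge-covered i 1+i<N i≢p 1+i≢p with vertex i (≤-trans (n≤1+n _) 1+i<N) | vertex (suc i) 1+i<N
      ... | u , eu | w , ew = one-inside S eu ew (no-edge-outside {G = T} proper determines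
        (next-adj (trans (cong suc eu) (sym ew)))
        (proj₂ (next-neighbors eu ew i≢p)) (proj₂ (prev-neighbors eu ew 1+i≢p)))

      -- The only neighbor of the leaf fills both places in `neighbors-differ`, so it would differ
      -- from itself in color.
      leaf-inside : ∀ {i} → suc i ≡ N → f i ≡ inside
      leaf-inside {zero} ()
      leaf-inside {suc i} 2+i≡N
        with vertex i (≤-trans (n≤1+n _) (≤-reflexive 2+i≡N))
           | vertex (suc i) (≤-reflexive 2+i≡N)
      ... | u , eu | v , ev with v ∈? S
      ...   | yes v∈S = trans (cong f (sym ev)) (side-inside v∈S)
      ...   | no v∉S  = contradiction refl (neighbors-differ {G = T} proper determines
                (leaf-neighbors eu ev
                  (λ e → 1+n≰n (≤-trans 2+p≤N (≤-reflexive (trans (sym 2+i≡N) (cong suc e)))))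
                  (≤-reflexive (sym 2+i≡N)))
                v∉S)

      -- Here `x` is the vertex of degree three, `l` and `r` are its neighbors along the path, and
      -- `z` is the other end of the chord.
      module _ {x l r z : Fin N} (ex : toℕ x ≡ p)
               (el : toℕ l ≡ suc p₀) (er : toℕ r ≡ suc p) (ez : toℕ z ≡ 0) where

        center-neighbors : ∀ {t} → Adj T x t → t ≡ l ⊎ t ≡ r ⊎ t ≡ z
        center-neighbors {t} a with adj⇒link a
        ... | inj₁ e = inj₂ (inj₁ (same (trans (sym e) (cong suc ex)) er))
        ... | inj₂ (inj₁ e) = inj₁ (same (suc-injective (trans e ex)) el)
        ... | inj₂ (inj₂ (inj₂ (_ , t≡0))) = inj₂ (inj₂ (same t≡0 ez))
        ... | inj₂ (inj₂ (inj₁ (x≡0 , _))) with trans (sym ex) x≡0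
        ...   | ()

        l-neighbors : ∃[ a ] NeighborsIn T l x a
        l-neighbors = next-neighbors el ex λ e → 1+n≰n (≤-reflexive (sym e))

        r-neighbors : ∃[ a ] NeighborsIn T r x a
        r-neighbors = prev-neighbors ex er λ e → 1+n≰n (≤-reflexive e)

        z-neighbors : ∃[ a ] NeighborsIn T z x a
        z-neighbors with vertex 1 (s≤s (s≤s z≤n))
        ... | w , ew = w , swapped ∘ adj⇒link
          where
          swapped : ∀ {t} → Link p (toℕ z) (toℕ t) → t ≡ x ⊎ t ≡ w
          swapped (inj₁ e) = inj₂ (same (trans (sym e) (cong suc ez)) ew)
          swapped (inj₂ (inj₁ e)) with trans e ez
          ... | ()
          swapped (inj₂ (inj₂ (inj₁ (_ , e)))) = inj₁ (same e ex)
          swapped (inj₂ (inj₂ (inj₂ (z≡p , _)))) with trans (sym ez) z≡p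
          ... | ()

        xl : Adj T x l
        xl = symmetric T (next-adj (trans (cong suc el) (sym ex)))

        xr : Adj T x r
        xr = next-adj (trans (cong suc ex) (sym er))

        xz : Adj T x z
        xz = symmetric T (chord-adj ez ex)

        module _ (x∉S : x ∉ S) where

          -- The remaining neighbor `z` plays the role of `d`. With the two analogues below, at most
          -- one neighbor of `x` lies outside `S`.
          l-or-r : f (suc p₀) ≡ inside ⊎ f (suc p) ≡ inside
          l-or-r = one-inside S el er (no-cherry-outside {G = T} proper determines xl xr
            center-neighbors (proj₂ l-neighbors) (proj₂ r-neighbors) x∉S)

          l-or-z : f (suc p₀) ≡ inside ⊎ f 0 ≡ inside
          l-or-z = one-inside S el ez (no-cherry-outside {G = T} proper determines xl xz
            ([ inj₁ , [ inj₂ ∘ inj₂ , inj₂ ∘ inj₁ ]′ ]′ ∘ center-neighbors)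
            (proj₂ l-neighbors) (proj₂ z-neighbors) x∉S)

          r-or-z : f (suc p) ≡ inside ⊎ f 0 ≡ inside
          r-or-z = one-inside S er ez (no-cherry-outside {G = T} proper determines xr xz
            ([ inj₂ ∘ inj₂ , [ inj₁ , inj₂ ∘ inj₁ ]′ ]′ ∘ center-neighbors)
            (proj₂ r-neighbors) (proj₂ z-neighbors) x∉S)

      -- Only the two path edges at `p` escape `edge-covered`; they are left as assumptions for the
      -- case analysis.
      covered : ∀ i → suc i < N →
        (suc i ≡ p → Covered f (suc p₀)) → (i ≡ p → Covered f p) → Covered f i
      covered i 1+i<N below above with suc i ℕ.≟ p | i ℕ.≟ p
      ... | yes refl | _        = below refl
      ... | no _     | yes refl = above refl
      ... | no 1+i≢p | no i≢p   = edge-covered i 1+i<N i≢p 1+i≢p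

    half : N ≤ ∣ S ∣ * 2
    half = subst (λ k → N ≤ k * 2) (count-side S) (by-center (inside-or-outside (f p)))
      where
      by-center : f p ≡ inside ⊎ f p ≡ outside → N ≤ count f N * 2
      by-center (inj₁ fp) =
        half-if-last f N (λ i i<N → covered i i<N (λ _ → inj₂ fp) (λ _ → inj₁ fp)) leaf-inside
      by-center (inj₂ fp)
        with vertex (suc p₀) (≤-trans (n≤1+n _) p<N) | vertex p p<N
           | vertex (suc p) 2+p≤N | vertex 0 (s≤s z≤n)
      ... | l , el | x , ex | r , er | z , ez =
        by-arms (inside-or-outside (f (suc p₀))) (inside-or-outside (f (suc p)))
        where
        x∉S : x ∉ S
        x∉S = side-outside ex fp

        the : ∀ {i j} → f i ≡ inside ⊎ f j ≡ inside → f i ≡ outside → f j ≡ inside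
        the (inj₂ fj) _  = fj
        the (inj₁ fi) fi′ with trans (sym fi) fi′
        ... | ()

        by-arms : f (suc p₀) ≡ inside ⊎ f (suc p₀) ≡ outside →
          f (suc p) ≡ inside ⊎ f (suc p) ≡ outside → N ≤ count f N * 2
        by-arms (inj₁ fl) (inj₁ fr) =
          half-if-last f N (λ i i<N → covered i i<N (λ _ → inj₁ fl) (λ _ → inj₂ fr)) leaf-inside
        -- The cut falls between `p` and `suc p`; `r-or-z` puts vertex 0 inside, as the lower block
        -- requires.
        by-arms (inj₁ fl) (inj₂ fr) =
          half-if-cut f (suc p) (suc m₀) (sym (+-suc p (suc m₀))) (the (r-or-z ex el er ez x∉S) fr)
            (λ i i<N cut → covered i i<N (λ _ → inj₁ fl) (λ i≡p → contradiction (cong suc i≡p) cut))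
            leaf-inside
        -- The cut falls between `suc p₀` and `p`. The other two neighbors of `p` are inside: `z`
        -- starts the lower block, and `r` covers the edge above `p`.
        by-arms (inj₂ fl) _ =
          half-if-cut f p m refl (the (l-or-z ex el er ez x∉S) fl)
            (λ i i<N cut → covered i i<N (λ 1+i≡p → contradiction 1+i≡p cut)
              (λ _ → inj₂ (the (l-or-r ex el er ez x∉S) fl)))
            leaf-inside

  -- Proper colorings of the tadpole

  proper-if : ∀ {k} (f : ℕ → Fin k) → (∀ i → f i ≢ f (suc i)) → f 0 ≢ f p → Proper T (f ∘ toℕ)
  proper-if f path chord {u} {v} a with adj⇒link a
  ... | inj₁ e = λ fu≡fv → path (toℕ u) (trans fu≡fv (cong f (sym e)))
  ... | inj₂ (inj₁ e) = λ fu≡fv → path (toℕ v) (trans (sym fu≡fv) (cong f (sym e)))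
  ... | inj₂ (inj₂ (inj₁ (eu , ev))) =
    λ fu≡fv → chord (trans (cong f (sym eu)) (trans fu≡fv (cong f ev)))
  ... | inj₂ (inj₂ (inj₂ (eu , ev))) =
    λ fu≡fv → chord (trans (cong f (sym ev)) (trans (sym fu≡fv) (cong f eu)))

  -- Each step along the path forces the opposite color. This gives uniqueness for even cycles and,
  -- with the chord, a contradiction for odd ones.
  two-coloring : ∀ {d : Fin N → Fin 2} → Proper T d →
    ∀ i {u} → toℕ u ≡ i → d u ≡ alternating (d 0F) i
  two-coloring {d} proper zero    eu = cong d (same eu refl)
  two-coloring {d} proper (suc i) {u} eu
    with vertex i (≤-trans (n≤1+n _) (subst (_< N) eu (toℕ<n u)))
  ... | w , ew = trans (second-color (d w) (d u) (proper (next-adj (trans (cong suc ew) (sym eu)))))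
    (cong opposite (two-coloring proper i ew))

  not-1-colorable : ¬ Colorable T 1
  not-1-colorable (c , proper) = proper {0F} {1F} (next-adj refl) (all-equal (c 0F) (c 1F))
    where
    all-equal : (x y : Fin 1) → x ≡ y
    all-equal 0F 0F = refl

  -- Even cycles

  module Bipartite (s : ℕ) (p₀≡ : p₀ ≡ suc (s * 2)) where

    proper : Proper T (alternating 0F ∘ toℕ)
    proper = proper-if (alternating 0F) (λ i e → opposite-differs (alternating 0F i) (sym e)) chord
      where
      chord : 0F ≢ alternating 0F p
      chord e with trans e (trans (cong (alternating 0F ∘ (2 +_)) p₀≡)
        (cong opposite (alternating-even 0F (suc s))))
      ... | ()

    chromatic : IsChromaticNumber T 2
    chromatic = (_ , proper) , at-least-2
      where
      at-least-2 : ∀ j → Colorable T j → 2 ≤ j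
      at-least-2 j colorable with 2 ≤? j
      ... | yes 2≤j = 2≤j
      ... | no 2≰j  =
        contradiction (Colorable-mono {G = T} (s≤s⁻¹ (≰⇒> 2≰j)) colorable) not-1-colorable

    determines : Determines T ⁅ 0F ⁆ (alternating 0F ∘ toℕ)
    determines proper′ agree u = trans (cong (λ x → alternating x (toℕ u)) (agree (x∈⁅x⁆ 0F)))
      (sym (two-coloring proper′ (toℕ u) refl))

    nonempty : ∀ S → AdmitsSudokuColoring T 2 S → 1 ≤ ∣ S ∣
    nonempty S admits with any? (_∈? S)
    ... | yes (u , u∈S) = subst (_≤ ∣ S ∣) (∣⁅x⁆∣≡1 u)
      (p⊆q⇒∣p∣≤∣q∣ λ w∈ → subst (_∈ S) (sym (x∈⁅y⁆⇒x≡y u w∈)) u∈S)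
    ... | no empty with admits⇒determines {G = T} admits
    ...   | c , proper , determines = contradiction refl
      -- For empty `S`, the colors of vertices 0 and 1 can be exchanged on the whole graph, which
      -- has no boundary.
      (kempe {G = T} {S} {c} proper determines {K = λ _ → ⊤} (λ _ → yes tt)
        (proper {0F} {1F} (next-adj refl)) (λ _ u∈S → empty (_ , u∈S))
        (λ _ _ ¬K → contradiction tt ¬K) tt)

    sudoku-number : IsSudokuNumber T 1
    sudoku-number = 2 , chromatic
      , (⁅ 0F ⁆ , ∣⁅x⁆∣≡1 {N} 0F , determines⇒admits {G = T} proper determines)
      , nonempty

  -- Odd cycles

  module NonBipartite (s : ℕ) (p₀≡ : p₀ ≡ s * 2) where

    -- As `p` is even, it would repeat the color of vertex 0, against the chord.
    not-2-colorable : ¬ Colorable T 2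
    not-2-colorable (d , proper) with vertex p p<N
    ... | u , eu = proper (chord-adj {0F} refl eu)
      (sym (trans (two-coloring proper p eu)
        (trans (cong (alternating (d 0F) ∘ (2 +_)) p₀≡) (alternating-even (d 0F) (suc s)))))

    colors₁-at-p : colors₁ (suc p₀) ≡ 2F
    colors₁-at-p = trans (cong (colors₁ ∘ suc) p₀≡) (colors₁-odd s)

    proper : Proper T (colors ∘ toℕ)
    proper = proper-if colors colors-step λ e → contradiction (trans e colors₁-at-p) λ ()

    chromatic : IsChromaticNumber T 3
    chromatic = (_ , proper) , at-least-3
      where
      at-least-3 : ∀ j → Colorable T j → 3 ≤ j
      at-least-3 j colorable with 3 ≤? j
      ... | yes 3≤j = 3≤j
      ... | no 3≰j  =
        contradiction (Colorable-mono {G = T} (s≤s⁻¹ (≰⇒> 3≰j)) colorable) not-2-colorable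

    determines : Determines T (alternate N) (colors ∘ toℕ)
    determines {d} proper′ agree = everywhere
      where
      c : Fin N → Fin 3
      c = colors ∘ toℕ

      between : ∀ {a b u} → Adj T u a → Adj T u b → c a ≢ c b → c a ≡ d a → c b ≡ d b → c u ≡ d u
      between {a} {b} {u} ua ub ca≢cb ca≡da cb≡db =
        third-color-unique (c a) (c b) (c u) (d u) ca≢cb (proper ua) (proper ub)
          (λ e → proper′ ua (trans e ca≡da)) (λ e → proper′ ub (trans e cb≡db))

      -- Unless prescribed itself, the vertex lies between two prescribed odd vertices of different
      -- colors.
      at-even : ∀ j {u} → toℕ u ≡ suc j * 2 → c u ≡ d u
      at-even j {u} eu with u ∈? alternate N
      ... | yes u∈ = agree u∈
      ... | no u∉ with ∉alternate⇒even u u∉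
      ...   | _ , 1+u<N
        with vertex (suc (j * 2)) (≤-trans (n≤1+n _) (subst (_< N) eu (toℕ<n u)))
           | vertex (suc (suc j * 2)) (subst (λ i → suc i < N) eu 1+u<N)
      ...     | a , ea | b , eb = between
        (symmetric T (next-adj (trans (cong suc ea) (sym eu))))
        (next-adj (trans (cong suc eu) (sym eb)))
        (λ e → colors₁-even-step j (trans (cong colors (sym ea)) (trans e (cong colors eb))))
        (agree (odd∈alternate a j ea)) (agree (odd∈alternate b (suc j) eb))

      -- This comes after `at-even`, which settles the positive even vertex `p`; vertex 1 is
      -- prescribed.
      at-zero : ∀ {u} → toℕ u ≡ 0 → c u ≡ d u
      at-zero eu with vertex p p<N
      ... | a , ea = between {1F} {a} (next-adj (cong suc eu)) (chord-adj eu ea)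
        (λ e → contradiction (trans e (trans (cong colors ea) colors₁-at-p)) λ ())
        (agree (odd∈alternate 1F 0 refl))
        (at-even s (trans ea (cong (2 +_) p₀≡)))

      everywhere : ∀ u → c u ≡ d u
      everywhere u with u ∈? alternate N
      ... | yes u∈ = agree u∈
      ... | no u∉ with ∉alternate⇒even u u∉
      ...   | (zero  , eu) , _ = at-zero eu
      ...   | (suc j , eu) , _ = at-even j eu

    -- The successor rounds the half of `N` up, as `N` may be odd while the bound from `half` is an
    -- even number.
    at-least-half : ∀ S → AdmitsSudokuColoring T 3 S → ⌊ suc N /2⌋ ≤ ∣ S ∣
    at-least-half S admits with admits⇒determines {G = T} admits
    ... | c , proper , determines =
      ≤-trans (⌊n/2⌋-mono (s≤s (half proper determines))) (≤-reflexive (⌊1+k*2/2⌋ ∣ S ∣))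

    sudoku-number : IsSudokuNumber T ⌊ suc N /2⌋
    sudoku-number = 3 , chromatic
      , (alternate N , ∣alternate∣ N , determines⇒admits {G = T} proper determines)
      , at-least-half

theorem3p8 : ∀ (n m : ℕ) (n≥3 : 3 ≤ n) → 2 ≤ m →
    (2 ∣ n → IsSudokuNumber (tadpole n m n≥3) 1)
    × (¬ (2 ∣ n) → IsSudokuNumber (tadpole n m n≥3) ⌊ n + m /2⌋)
theorem3p8 (suc (suc (suc p₀))) (suc (suc m₀)) n≥3@(s≤s (s≤s (s≤s _))) (s≤s (s≤s _)) = even , odd
  where
  open Tadpole p₀ m₀ n≥3

  even : 2 ∣ 3 + p₀ → IsSudokuNumber T 1
  -- The quotients 0 and 1 are impossible, as the cycle has at least three vertices.
  even (divides (suc (suc s)) e) =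
    Bipartite.sudoku-number s (suc-injective (suc-injective (suc-injective e)))

  odd : ¬ (2 ∣ 3 + p₀) → IsSudokuNumber T ⌊ suc N /2⌋
  odd ¬even with even-or-odd p₀
  ... | inj₁ (s , e) = NonBipartite.sudoku-number s e
  ... | inj₂ (s , e) = contradiction (divides (suc (suc s)) (cong (3 +_) e)) ¬even
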